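{- Let $\mathbb{k}$ be a nontrivial semiring, let $K, L$ be simplicial complexes over a type $E$, let $s \in K$ be a face and let $x \in E$ with $x \notin V(K)$. Then, as complexes over $E \times \mathbb{k}$, \[ (\sigma_s K) \star L = \sigma_{s \sqcup_s \emptyset}(K \star L), \] where $\sigma_s K$ is taken with barycenter $x$ and $\sigma_{s \sqcup_s \emptyset}(K \star L)$ is taken with barycenter $(x,0)$.
   Context: A simplicial complex over a type (set) $E$ is a set $K$ of nonempty finite subsets of $E$ (its faces) such that every nonempty subset of a face is a face. It may be empty or infinite, and not every element of $E$ need be a vertex. $V(K) = \{x \in E \mid \{x\} \in K\}$. For a finite set $s \subseteq E$: $\mathrm{Lk}(K,s) = \{t \in K \mid s \cup t \in K,\ s \cap t = \emptyset\}$; $\partial s = \{t \subseteq s \mid t \ne \emptyset,\ t \neq s\}$. For finite $s,t \subseteq E$, $s \sqcup_s t = (s \times \{0\}) \cup (t \times \{1\}) \subseteq E \times \mathbb{k}$ (the subscript in $\sqcup_s$ is part of the symbol and unrelated to the set $s$). The join $K \star L$ of complexes over $E$ is the complex over $E \times \mathbb{k}$ with faces $\{s \sqcup_s t \mid s \in K \cup \{\emptyset\},\ t \in L \cup \{\emptyset\}\} \setminus \{\emptyset\}$. For a complex $K$ over a type $E$, a face $s \in K$ and $x \in E \setminus V(K)$, the stellar subdivision $\sigma_s K$ of $K$ at $s$ with barycenter $x$ is the complex over $E$ whose faces are the faces of $K$ not containing $s$ together with all nonempty sets $a \cup b \cup c$ with $a \in \mathrm{Lk}(K,s) \cup \{\emptyset\}$,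 $b \in \partial s \cup \{\emptyset\}$, $c \in \{\emptyset, \{x\}\}$. -}

module Defs where

open import Algebra.Bundles using (Semiring)
open import Data.Empty using (⊥-elim)
open import Data.List.Base using (List; []; _∷_; [_]; _++_; map)
open import Data.List.Membership.Setoid.Properties
  using (∈-++⁺ˡ; ∈-++⁺ʳ; ∈-++⁻; ∈-map⁻; ∈-resp-≈)
open import Data.List.Relation.Unary.Any using (here; there)
open import Data.Product.Base using (∃₂; ∃-syntax; _×_; _,_; proj₁; proj₂)
open import Data.Product.Relation.Binary.Pointwise.NonDependent using (_×ₛ_)
open import Data.Sum.Base using (_⊎_; inj₁; inj₂)
open import Level using (Level; _⊔_; suc)
open import Relation.Binary.Bundles using (Setoid)
open import Relation.Binary.PropositionalEquality using (_≡_; _≢_; refl)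
open import Relation.Nullary.Negation using (¬_)
open import Relation.Unary using (Pred; _∪_; ｛_｝; _≐_)
import Data.List.Membership.Setoid as Membership
import Data.List.Relation.Binary.Disjoint.Setoid as Disj
import Data.List.Relation.Binary.Subset.Setoid as Subset

private
  variable
    e ε r ρ p q : Level

-- The finite subsets of a setoid E are represented by lists of elements of E,
-- where order and multiplicity are irrelevant: _≋_ is equality of subsets,
-- _++_ is union, and [] (and no other list) is the empty subset.

module FiniteSubsets (E : Setoid e ε) where

  open Setoid E using (Carrier) renaming (refl to ≈-refl; sym to ≈-sym)
  open Membership E public using (_∈_)
  open Subset E public using (_⊆_; _⊈_)
  open Disj E public using (Disjoint)

  FinSubset : Set e
  FinSubset = List Carrier

  infix 4 _≋_

  _≋_ : FinSubset → FinSubset → Set (e ⊔ ε)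
  s ≋ t = s ⊆ t × t ⊆ s

  ⊆[]⇒≡[] : ∀ {s} → s ⊆ [] → s ≡ []
  ⊆[]⇒≡[] {[]}    _ = refl
  ⊆[]⇒≡[] {x ∷ s} h with () ← h (here ≈-refl)

  empty? : ∀ (s : FinSubset) → s ≡ [] ⊎ s ≢ []
  empty? []      = inj₁ refl
  empty? (_ ∷ _) = inj₂ λ ()

  ∷-⊆ : ∀ {x s t} → x ∈ t → s ⊆ t → (x ∷ s) ⊆ t
  ∷-⊆ x∈t s⊆t (here y≈x)  = ∈-resp-≈ E (≈-sym y≈x) x∈t
  ∷-⊆ x∈t s⊆t (there y∈s) = s⊆t y∈s

  ++-⊆ : ∀ {s t u} → s ⊆ u → t ⊆ u → (s ++ t) ⊆ u
  ++-⊆ {s} s⊆u t⊆u x∈ with ∈-++⁻ E s x∈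
  ... | inj₁ x∈s = s⊆u x∈s
  ... | inj₂ x∈t = t⊆u x∈t

  ++-mono-⊆ : ∀ {s s′ t t′} → s ⊆ s′ → t ⊆ t′ → (s ++ t) ⊆ (s′ ++ t′)
  ++-mono-⊆ {s} {s′} h k =
    ++-⊆ {s} (λ y → ∈-++⁺ˡ E (h y)) (λ y → ∈-++⁺ʳ E s′ (k y))

  ++-cong : ∀ {s s′ t t′} → s ≋ s′ → t ≋ t′ → (s ++ t) ≋ (s′ ++ t′)
  ++-cong {s} {s′} (h , h′) (k , k′) = ++-mono-⊆ {s} h k , ++-mono-⊆ {s′} h′ k′

  ≋-refl : ∀ {s} → s ≋ s
  ≋-refl = (λ y → y) , (λ y → y)

  ≋-trans : ∀ {s t u} → s ≋ t → t ≋ u → s ≋ u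
  ≋-trans (h , h′) (k , k′) = (λ y → k (h y)) , (λ y → h′ (k′ y))

  ⊆-split : ∀ t {t′ u} → u ⊆ (t ++ t′) →
            ∃₂ λ v v′ → v ⊆ t × v′ ⊆ t′ × u ≋ v ++ v′
  ⊆-split t {u = []}    _ = [] , [] , (λ ()) , (λ ()) , ≋-refl
  ⊆-split t {u = x ∷ u} h
    with ⊆-split t {u = u} (λ y → h (there y)) | ∈-++⁻ E t (h (here ≈-refl))
  ... | v , v′ , v⊆t , v′⊆t′ , u≋ | inj₁ x∈t =
    x ∷ v , v′ , ∷-⊆ x∈t v⊆t , v′⊆t′ ,
    ++-cong {s = [ x ]} ≋-refl u≋
  ... | v , v′ , v⊆t , v′⊆t′ , (u⊆ , ⊆u) | inj₂ x∈t′ =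
    v , x ∷ v′ , v⊆t , ∷-⊆ x∈t′ v′⊆t′ ,
    ∷-⊆ (∈-++⁺ʳ E v (here ≈-refl))
        (λ y → ++-mono-⊆ {v} (λ z → z) there (u⊆ y)) ,
    ++-⊆ {v} (λ y → there (⊆u (∈-++⁺ˡ E y)))
         (∷-⊆ (here ≈-refl) (λ y → there (⊆u (∈-++⁺ʳ E v y))))

-- Faces form a set of finite subsets, i.e. `Face` respects _≋_: this follows
-- from the two axioms.

record SimplicialComplex (E : Setoid e ε) (p : Level)
       : Set (e ⊔ ε ⊔ suc p) where
  open FiniteSubsets E
  field
    Face        : Pred FinSubset p
    nonempty    : ∀ {s} → Face s → s ≢ []
    down-closed : ∀ {s t} → Face s → t ⊆ s → t ≢ [] → Face t

  Vertex : Pred (Setoid.Carrier E) p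
  Vertex x = Face [ x ]

open SimplicialComplex public using (Face; Vertex)

infix 4 _≅_

_≅_ : {E : Setoid e ε} →
      SimplicialComplex E p → SimplicialComplex E q → Set (e ⊔ p ⊔ q)
K ≅ L = Face K ≐ Face L

module _ {E : Setoid e ε} where

  open FiniteSubsets E
  open Setoid E using (Carrier)

  Link : SimplicialComplex E p → FinSubset → Pred FinSubset (e ⊔ ε ⊔ p)
  Link K s t = Face K t × Face K (s ++ t) × Disjoint s t

  ∂ : FinSubset → Pred FinSubset (e ⊔ ε)
  ∂ s t = t ⊆ s × t ≢ [] × ¬ (t ≋ s)

  StellarFace : SimplicialComplex E p → FinSubset → Carrier →
                Pred FinSubset (e ⊔ ε ⊔ p)
  StellarFace K s x u =
      (Face K u × s ⊈ u)
    ⊎ (u ≢ [] × (∃[ a ] ∃[ b ] ∃[ c ]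
          (Link K s ∪ ｛ [] ｝) a
        × (∂ s ∪ ｛ [] ｝) b
        × (｛ [] ｝ ∪ ｛ [ x ] ｝) c
        × u ≋ a ++ b ++ c))

  private
    module _ (K : SimplicialComplex E p) (s : FinSubset) (x : Carrier) where

      link↓ : ∀ {a a′} → (Link K s ∪ ｛ [] ｝) a → a′ ⊆ a →
              (Link K s ∪ ｛ [] ｝) a′
      link↓ (inj₂ refl) a′⊆a with refl ← ⊆[]⇒≡[] a′⊆a = inj₂ refl
      link↓ {a} {[]} (inj₁ _) _ = inj₂ refl
      link↓ {a} {y ∷ a′} (inj₁ (fa , fsa , disj)) a′⊆a = inj₁
        ( SimplicialComplex.down-closed K fa a′⊆a (λ ())
        , SimplicialComplex.down-closed K fsa (++-mono-⊆ {s} (λ z → z) a′⊆a)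
            (s++∷≢[] s)
        , λ (v∈s , v∈a′) → disj (v∈s , a′⊆a v∈a′))
        where
        s++∷≢[] : ∀ t → t ++ y ∷ a′ ≢ []
        s++∷≢[] []      ()
        s++∷≢[] (_ ∷ _) ()

      ∂↓ : ∀ {b b′} → (∂ s ∪ ｛ [] ｝) b → b′ ⊆ b → (∂ s ∪ ｛ [] ｝) b′
      ∂↓ (inj₂ refl) b′⊆b with refl ← ⊆[]⇒≡[] b′⊆b = inj₂ refl
      ∂↓ {b} {[]} (inj₁ _) _ = inj₂ refl
      ∂↓ {b} {_ ∷ _} (inj₁ (b⊆s , _ , b≢s)) b′⊆b = inj₁
        ( (λ y → b⊆s (b′⊆b y)) , (λ ())
        , λ (_ , s⊆b′) → b≢s (b⊆s , λ y → b′⊆b (s⊆b′ y)))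

      cone↓ : ∀ {c c′} → (｛ [] ｝ ∪ ｛ [ x ] ｝) c → c′ ⊆ c →
              ∃[ c″ ] (｛ [] ｝ ∪ ｛ [ x ] ｝) c″ × c′ ≋ c″
      cone↓ (inj₁ refl) c′⊆c with refl ← ⊆[]⇒≡[] c′⊆c = [] , inj₁ refl , ≋-refl
      cone↓ {c} {[]} (inj₂ refl) _ = [] , inj₁ refl , ≋-refl
      cone↓ {c} {y ∷ c′} (inj₂ refl) c′⊆c =
        [ x ] , inj₂ refl , c′⊆c ,
        ∷-⊆ (x∈ (c′⊆c (here (Setoid.refl E)))) (λ ())
        where
        x∈ : y ∈ [ x ] → x ∈ (y ∷ c′)
        x∈ (here y≈x) = here (Setoid.sym E y≈x)

  -- The stellar subdivision of K at s with barycenter x. The side conditions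
  -- do not enter into the definition of the faces.
  σ : (K : SimplicialComplex E p)
      (s : FinSubset) → Face K s →
      (x : Carrier) → ¬ Vertex K x →
      SimplicialComplex E (e ⊔ ε ⊔ p)
  σ K s _ x _ = record
    { Face        = StellarFace K s x
    ; nonempty    = λ where
        (inj₁ (f , _))   → SimplicialComplex.nonempty K f
        (inj₂ (u≢[] , _)) → u≢[]
    ; down-closed = down
    }
    where
    down : ∀ {u t} → StellarFace K s x u → t ⊆ u → t ≢ [] → StellarFace K s x t
    down (inj₁ (f , s⊈u)) t⊆u t≢[] = inj₁
      ( SimplicialComplex.down-closed K f t⊆u t≢[]
      , λ s⊆t → s⊈u (λ y → t⊆u (s⊆t y)))
    down (inj₂ (_ , a , b , c , la , ∂b , cc , (u⊆ , _))) t⊆u t≢[]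
      with a′ , w , a′⊆a , w⊆ , t≋ ← ⊆-split a (λ y → u⊆ (t⊆u y))
      with b′ , c′ , b′⊆b , c′⊆c , w≋ ← ⊆-split b w⊆
      with c″ , cc″ , c′≋ ← cone↓ K s x cc c′⊆c
      = inj₂ (t≢[] , a′ , b′ , c″ , link↓ K s x la a′⊆a , ∂↓ K s x ∂b b′⊆b , cc″ ,
          ≋-trans t≋ (++-cong {s = a′} ≋-refl
            (≋-trans w≋ (++-cong {s = b′} ≋-refl c′≋))))

module _ (E : Setoid e ε) (𝕜 : Semiring r ρ) where

  E×𝕜 : Setoid (e ⊔ r) (ε ⊔ ρ)
  E×𝕜 = E ×ₛ Semiring.setoid 𝕜

Nontrivial : Semiring r ρ → Set ρ
Nontrivial 𝕜 = ¬ (0# ≈ 1#)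
  where open Semiring 𝕜

infix 6 _⊔ₛ[_]_

_⊔ₛ[_]_ : {A : Set e} → List A → (𝕜 : Semiring r ρ) → List A →
          List (A × Semiring.Carrier 𝕜)
s ⊔ₛ[ 𝕜 ] t = map (_, 0#) s ++ map (_, 1#) t
  where open Semiring 𝕜

module _ {E : Setoid e ε} (𝕜 : Semiring r ρ) where

  open Semiring 𝕜 using (0#; 1#)

  private
    module 𝕊 = FiniteSubsets E
    module ℙ = FiniteSubsets (E×𝕜 E 𝕜)

  JoinFace : SimplicialComplex E p → SimplicialComplex E q →
             Pred ℙ.FinSubset (e ⊔ ε ⊔ r ⊔ ρ ⊔ p ⊔ q)
  JoinFace K L u =
    u ≢ [] × (∃[ s ] ∃[ t ]
        (Face K ∪ ｛ [] ｝) s × (Face L ∪ ｛ [] ｝) t × u ℙ.≋ s ⊔ₛ[ 𝕜 ] t)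

  private
    ⊆-map : ∀ z {s u} → u ℙ.⊆ map (_, z) s →
            ∃[ s′ ] s′ 𝕊.⊆ s × u ℙ.≋ map (_, z) s′
    ⊆-map z {u = []} _ = [] , (λ ()) , ℙ.≋-refl
    ⊆-map z {u = y ∷ u} h
      with s′ , s′⊆s , (u⊆ , ⊆u) ← ⊆-map z {u = u} (λ v → h (there v))
      with w , w∈s , y≈w ← ∈-map⁻ E (E×𝕜 E 𝕜) (h (here (Setoid.refl (E×𝕜 E 𝕜))))
      = w ∷ s′ , 𝕊.∷-⊆ w∈s s′⊆s
      , ℙ.∷-⊆ (here y≈w) (λ v → there (u⊆ v))
      , ℙ.∷-⊆ (here (Setoid.sym (E×𝕜 E 𝕜) y≈w)) (λ v → there (⊆u v))

    ∪∅↓ : (K : SimplicialComplex E p) → ∀ {s s′} →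
          (Face K ∪ ｛ [] ｝) s → s′ 𝕊.⊆ s → (Face K ∪ ｛ [] ｝) s′
    ∪∅↓ K (inj₂ refl) s′⊆s with refl ← 𝕊.⊆[]⇒≡[] s′⊆s = inj₂ refl
    ∪∅↓ K {s′ = []}    (inj₁ _) _ = inj₂ refl
    ∪∅↓ K {s′ = _ ∷ _} (inj₁ f) s′⊆s =
      inj₁ (SimplicialComplex.down-closed K f s′⊆s (λ ()))

  join : SimplicialComplex E p → SimplicialComplex E q →
         SimplicialComplex (E×𝕜 E 𝕜) (e ⊔ ε ⊔ r ⊔ ρ ⊔ p ⊔ q)
  join K L = record
    { Face        = JoinFace K L
    ; nonempty    = proj₁
    ; down-closed = down
    }
    where
    down : ∀ {u v} → JoinFace K L u → v ℙ.⊆ u → v ≢ [] → JoinFace K L v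
    down (_ , s , t , fs , ft , (u⊆ , _)) v⊆u v≢[]
      with v₀ , v₁ , v₀⊆ , v₁⊆ , v≋ ← ℙ.⊆-split (map (_, 0#) s) (λ y → u⊆ (v⊆u y))
      with s′ , s′⊆s , v₀≋ ← ⊆-map 0# v₀⊆
      with t′ , t′⊆t , v₁≋ ← ⊆-map 1# v₁⊆
      = v≢[] , s′ , t′ , ∪∅↓ K fs s′⊆s , ∪∅↓ L ft t′⊆t
      , ℙ.≋-trans v≋ (ℙ.++-cong {s = v₀} v₀≋ v₁≋)

  module _ (K : SimplicialComplex E p) (L : SimplicialComplex E q) where

    join-face : ∀ {s} → Face K s → Face (join K L) (s ⊔ₛ[ 𝕜 ] [])
    join-face {[]}    f = ⊥-elim (SimplicialComplex.nonempty K f refl)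
    join-face {x ∷ s} f = (λ ()) , x ∷ s , [] , inj₁ f , inj₂ refl , ℙ.≋-refl

    join-¬vertex : Nontrivial 𝕜 → ∀ {x} → ¬ Vertex K x → ¬ Vertex (join K L) (x , 0#)
    join-¬vertex 0≉1 {x} x∉V (_ , s , t , fs , ft , (u⊆ , _))
      with ∈-++⁻ (E×𝕜 E 𝕜) (map (_, 0#) s) (u⊆ (here (Setoid.refl (E×𝕜 E 𝕜))))
    ... | inj₂ x∈t with _ , _ , (_ , 0≈1) ← ∈-map⁻ E (E×𝕜 E 𝕜) x∈t = 0≉1 0≈1
    ... | inj₁ x∈s
      with w , w∈s , (x≈w , _) ← ∈-map⁻ E (E×𝕜 E 𝕜) x∈s
      with ∪∅↓ K {s′ = [ x ]} fs
             (𝕊.∷-⊆ (∈-resp-≈ E (Setoid.sym E x≈w) w∈s) (λ ()))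
    ... | inj₁ x∈V = x∉V x∈V

infix 5 _⋆[_]_

_⋆[_]_ : {E : Setoid e ε} →
         SimplicialComplex E p → (𝕜 : Semiring r ρ) → SimplicialComplex E q →
         SimplicialComplex (E×𝕜 E 𝕜) (e ⊔ ε ⊔ r ⊔ ρ ⊔ p ⊔ q)
K ⋆[ 𝕜 ] L = join 𝕜 K L

{-# OPTIONS --safe #-}
-- The map (s , t) ↦ s ⊔ₛ t turns unions into unions, and it reflects inclusion
-- because 0 and 1 are distinct. So the link of s ⊔ₛ ∅ in K ⋆ L consists of the
-- a ⊔ₛ t with a in the link of s (or empty) and t in L (or empty), while the
-- boundary of s ⊔ₛ ∅ consists of the b ⊔ₛ ∅ with b ∈ ∂ s. The faces on both
-- sides are then matched through
--   (a ∪ b ∪ c) ⊔ₛ t = (a ⊔ₛ t) ∪ (b ⊔ₛ ∅) ∪ (c ⊔ₛ ∅).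
module Submission where

open import Defs
open import Algebra.Bundles using (Semiring)
open import Data.Empty using (⊥-elim)
open import Data.List.Base using (List; []; _∷_; [_]; _++_; map)
open import Data.List.Membership.Setoid.Properties
  using (∈-++⁺ˡ; ∈-++⁺ʳ; ∈-++⁻; ∈-map⁺; ∈-map⁻; ∈-resp-≈)
open import Data.List.Properties using (++-identityʳ)
open import Data.List.Relation.Unary.Any using (here)
open import Data.Product.Base using (∃₂; ∃-syntax; _×_; _,_; proj₁; proj₂)
open import Data.Sum.Base using (_⊎_; inj₁; inj₂)
open import Level using (Level)
open import Relation.Binary.Bundles using (Setoid)
open import Relation.Binary.PropositionalEquality using (_≡_; _≢_; refl; sym; subst)
open import Relation.Nullary.Negation using (¬_)
open import Relation.Unary using (Pred; _∪_; ｛_｝)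

private
  variable
    e ε r ρ p q : Level

module _ (E : Setoid e ε) where

  open FiniteSubsets E

  ⊆-≢[] : ∀ {s t} → s ⊆ t → s ≢ [] → t ≢ []
  ⊆-≢[] s⊆t s≢[] refl = s≢[] (⊆[]⇒≡[] s⊆t)

  ≋-sym : ∀ {s t} → s ≋ t → t ≋ s
  ≋-sym (h , k) = k , h

  -- Whether a list is empty is decidable, so `P` only has to be proved for nonempty `s`.
  ∪∅-intro : (P : Pred FinSubset p) → ∀ s → (s ≢ [] → P s) → (P ∪ ｛ [] ｝) s
  ∪∅-intro P s h with empty? s
  ... | inj₁ s≡[] = inj₂ (sym s≡[])
  ... | inj₂ s≢[] = inj₁ (h s≢[])

  face∪∅-down : (K : SimplicialComplex E p) → ∀ {s t} →
                (Face K ∪ ｛ [] ｝) s → t ⊆ s → t ≢ [] → Face K t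
  face∪∅-down K (inj₁ f)    t⊆s t≢[] = SimplicialComplex.down-closed K f t⊆s t≢[]
  face∪∅-down K (inj₂ refl) t⊆s t≢[] = ⊥-elim (t≢[] (⊆[]⇒≡[] t⊆s))

module _ (𝕜 : Semiring r ρ) (E : Setoid e ε) where

  open Semiring 𝕜 using (0#; 1#)
  private
    module 𝕜 = Semiring 𝕜
    module E = Setoid E
    P = E×𝕜 E 𝕜
    module 𝕊 = FiniteSubsets E
    module ℙ = FiniteSubsets P

  infix 6 _⊎ₛ_

  _⊎ₛ_ : 𝕊.FinSubset → 𝕊.FinSubset → ℙ.FinSubset
  s ⊎ₛ t = s ⊔ₛ[ 𝕜 ] t

  ∈-⊎ₛ⁺ˡ : ∀ {s t y} → y 𝕊.∈ s → (y , 0#) ℙ.∈ s ⊎ₛ t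
  ∈-⊎ₛ⁺ˡ y∈s = ∈-++⁺ˡ P (∈-map⁺ E P (λ y≈z → y≈z , 𝕜.refl) y∈s)

  ∈-⊎ₛ⁺ʳ : ∀ s {t y} → y 𝕊.∈ t → (y , 1#) ℙ.∈ s ⊎ₛ t
  ∈-⊎ₛ⁺ʳ s y∈t = ∈-++⁺ʳ P (map (_, 0#) s) (∈-map⁺ E P (λ y≈z → y≈z , 𝕜.refl) y∈t)

  -- The label `i` is known only up to `≈`. The two alternatives exclude each other only once `0#`
  -- and `1#` are distinct.
  ∈-⊎ₛ⁻ : ∀ s t {y i} → (y , i) ℙ.∈ s ⊎ₛ t →
          (y 𝕊.∈ s × i 𝕜.≈ 0#) ⊎ (y 𝕊.∈ t × i 𝕜.≈ 1#)
  ∈-⊎ₛ⁻ s t y∈ with ∈-++⁻ P (map (_, 0#) s) y∈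
  ... | inj₁ y∈s with _ , z∈s , y≈z , i≈0 ← ∈-map⁻ E P y∈s =
    inj₁ (∈-resp-≈ E (E.sym y≈z) z∈s , i≈0)
  ... | inj₂ y∈t with _ , z∈t , y≈z , i≈1 ← ∈-map⁻ E P y∈t =
    inj₂ (∈-resp-≈ E (E.sym y≈z) z∈t , i≈1)

  -- Membership respects the setoid equality, so it suffices to test points labelled exactly `0#` or
  -- `1#`.
  ⊎ₛ-⊆ : ∀ s t {u} → (∀ {y} → y 𝕊.∈ s → (y , 0#) ℙ.∈ u) →
         (∀ {y} → y 𝕊.∈ t → (y , 1#) ℙ.∈ u) → s ⊎ₛ t ℙ.⊆ u
  ⊎ₛ-⊆ s t h k y∈ with ∈-⊎ₛ⁻ s t y∈
  ... | inj₁ (y∈s , i≈0) = ∈-resp-≈ P (E.refl , 𝕜.sym i≈0) (h y∈s)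
  ... | inj₂ (y∈t , i≈1) = ∈-resp-≈ P (E.refl , 𝕜.sym i≈1) (k y∈t)

  ⊎ₛ-mono : ∀ {s s′ t t′} → s 𝕊.⊆ s′ → t 𝕊.⊆ t′ → s ⊎ₛ t ℙ.⊆ s′ ⊎ₛ t′
  ⊎ₛ-mono {s} {s′} {t} h k =
    ⊎ₛ-⊆ s t (λ y → ∈-⊎ₛ⁺ˡ (h y)) (λ y → ∈-⊎ₛ⁺ʳ s′ (k y))

  ⊎ₛ-++ : ∀ s t s′ t′ → (s ⊎ₛ t) ++ (s′ ⊎ₛ t′) ℙ.≋ (s ++ s′) ⊎ₛ (t ++ t′)
  ⊎ₛ-++ s t s′ t′ =
    ℙ.++-⊆ {s ⊎ₛ t} (⊎ₛ-mono {s} {t = t} (∈-++⁺ˡ E) (∈-++⁺ˡ E))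
                    (⊎ₛ-mono {s′} {t = t′} (∈-++⁺ʳ E s) (∈-++⁺ʳ E t)) ,
    ⊎ₛ-⊆ (s ++ s′) (t ++ t′) left right
    where
    left : ∀ {y} → y 𝕊.∈ s ++ s′ → (y , 0#) ℙ.∈ (s ⊎ₛ t) ++ (s′ ⊎ₛ t′)
    left y∈ with ∈-++⁻ E s y∈
    ... | inj₁ y∈s  = ∈-++⁺ˡ P (∈-⊎ₛ⁺ˡ y∈s)
    ... | inj₂ y∈s′ = ∈-++⁺ʳ P (s ⊎ₛ t) (∈-⊎ₛ⁺ˡ y∈s′)
    right : ∀ {y} → y 𝕊.∈ t ++ t′ → (y , 1#) ℙ.∈ (s ⊎ₛ t) ++ (s′ ⊎ₛ t′)
    right y∈ with ∈-++⁻ E t y∈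
    ... | inj₁ y∈t  = ∈-++⁺ˡ P (∈-⊎ₛ⁺ʳ s y∈t)
    ... | inj₂ y∈t′ = ∈-++⁺ʳ P (s ⊎ₛ t) (∈-⊎ₛ⁺ʳ s′ y∈t′)

  ⊎ₛ-++₃ : ∀ s t s′ s″ →
           (s ⊎ₛ t) ++ (s′ ⊎ₛ []) ++ (s″ ⊎ₛ []) ℙ.≋ (s ++ s′ ++ s″) ⊎ₛ t
  ⊎ₛ-++₃ s t s′ s″ =
    -- The inner union leaves `[] ++ []`, which computes; the outer one leaves `t ++ []`, equal to
    -- `t` only propositionally.
    subst (λ w → (s ⊎ₛ t) ++ (s′ ⊎ₛ []) ++ (s″ ⊎ₛ []) ℙ.≋ (s ++ s′ ++ s″) ⊎ₛ w)
      (++-identityʳ t)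
      (ℙ.≋-trans (ℙ.++-cong {s ⊎ₛ t} ℙ.≋-refl (⊎ₛ-++ s′ [] s″ []))
                 (⊎ₛ-++ s t (s′ ++ s″) []))

  ⊎ₛ-≢[] : ∀ {s t} → s ≢ [] → s ⊎ₛ t ≢ []
  ⊎ₛ-≢[] {[]}    s≢[] = ⊥-elim (s≢[] refl)
  ⊎ₛ-≢[] {_ ∷ _} _    = λ ()

  -- The second summand is empty, so every label in `u` is `≈ 0#`; the first components of `u` serve
  -- as `v`.
  ⊆-⊎ₛ[] : ∀ s {u} → u ℙ.⊆ s ⊎ₛ [] → ∃[ v ] v 𝕊.⊆ s × u ℙ.≋ v ⊎ₛ []
  ⊆-⊎ₛ[] s {[]}    _   = [] , (λ ()) , ℙ.≋-refl
  ⊆-⊎ₛ[] s {(y , i) ∷ u} u⊆s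
    with inj₁ (y∈s , i≈0) ← ∈-⊎ₛ⁻ s [] (u⊆s (here (Setoid.refl P)))
    with v , v⊆s , u≋v ← ⊆-⊎ₛ[] s {u} (λ z → u⊆s (∈-++⁺ʳ P [ y , i ] z))
    = y ∷ v , 𝕊.∷-⊆ y∈s v⊆s
    , ℙ.++-cong {[ y , i ]} {[ y , 0# ]}
        ( ℙ.∷-⊆ (here (E.refl , i≈0)) (λ ())
        , ℙ.∷-⊆ (here (E.refl , 𝕜.sym i≈0)) (λ ())) u≋v

  module _ (0≉1 : Nontrivial 𝕜) where

    -- Were `0# ≈ 1#`, the point could come from `t`. Reflection of inclusions and of disjointness
    -- rests on excluding this.
    ∈-⊎ₛ⁻ˡ : ∀ s t {y} → (y , 0#) ℙ.∈ s ⊎ₛ t → y 𝕊.∈ s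
    ∈-⊎ₛ⁻ˡ s t y∈ with ∈-⊎ₛ⁻ s t y∈
    ... | inj₁ (y∈s , _) = y∈s
    ... | inj₂ (_ , 0≈1) = ⊥-elim (0≉1 0≈1)

    ⊎ₛ-cancelˡ : ∀ s t s′ t′ → s ⊎ₛ t ℙ.⊆ s′ ⊎ₛ t′ → s 𝕊.⊆ s′
    ⊎ₛ-cancelˡ s t s′ t′ h y∈s = ∈-⊎ₛ⁻ˡ s′ t′ (h (∈-⊎ₛ⁺ˡ y∈s))

    -- A common point has label `0#`, since the second summand of `s ⊎ₛ []` is empty, so its first
    -- component lies in both `s` and `s′`.
    ⊎ₛ-disjoint : ∀ s s′ t → 𝕊.Disjoint s s′ → ℙ.Disjoint (s ⊎ₛ []) (s′ ⊎ₛ t)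
    ⊎ₛ-disjoint s s′ t disj (v∈s , v∈s′) with ∈-⊎ₛ⁻ s [] v∈s
    ... | inj₁ (y∈s , i≈0) =
      disj (y∈s , ∈-⊎ₛ⁻ˡ s′ t (∈-resp-≈ P (E.refl , i≈0) v∈s′))

    -- Properness survives because an inclusion of `s ⊎ₛ []` in `b ⊎ₛ []` would cancel to `s ⊆ b`.
    ∂-⊎ₛ : ∀ s {b} → (∂ {E = E} s ∪ ｛ [] ｝) b →
           (∂ {E = P} (s ⊎ₛ []) ∪ ｛ [] ｝) (b ⊎ₛ [])
    ∂-⊎ₛ s (inj₂ refl) = inj₂ refl
    ∂-⊎ₛ s {b} (inj₁ (b⊆s , b≢[] , b≉s)) = inj₁
      ( ⊎ₛ-mono {b} {t = []} b⊆s (λ ())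
      , ⊎ₛ-≢[] b≢[]
      , λ (_ , s⊆b) → b≉s (b⊆s , ⊎ₛ-cancelˡ s [] b [] s⊆b))

    ∂-⊎ₛ⁻ : ∀ s {b} → (∂ {E = P} (s ⊎ₛ []) ∪ ｛ [] ｝) b →
            ∃[ b′ ] (∂ {E = E} s ∪ ｛ [] ｝) b′ × b ℙ.≋ b′ ⊎ₛ []
    ∂-⊎ₛ⁻ s (inj₂ refl) = [] , inj₂ refl , ℙ.≋-refl
    ∂-⊎ₛ⁻ s (inj₁ (b⊆s , _ , b≉s)) with b′ , b′⊆s , b≋b′ ← ⊆-⊎ₛ[] s b⊆s =
      b′ , ∪∅-intro E (∂ {E = E} s) b′ (λ b′≢[] → b′⊆s , b′≢[] , λ (_ , s⊆b′) →
        -- If `s ⊆ b′`, then all of `s ⊎ₛ []` lies in `b`, so `b` is not proper.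
        b≉s (b⊆s , λ y → proj₂ b≋b′ (⊎ₛ-mono {s} {t = []} s⊆b′ (λ ()) y))) ,
      b≋b′

    module _ (K : SimplicialComplex E p) (L : SimplicialComplex E q) where

      -- For empty `a` and nonempty `t` the set is still in the link, because `s` itself is a face
      -- of `K`. Hence the choice between link and empty set is made on `a ⊎ₛ t` and not on `a`.
      link-⊎ₛ : ∀ {s a t} → Face K s →
                (Link K s ∪ ｛ [] ｝) a → (Face L ∪ ｛ [] ｝) t →
                (Link (K ⋆[ 𝕜 ] L) (s ⊎ₛ []) ∪ ｛ [] ｝) (a ⊎ₛ t)
      link-⊎ₛ {s} {a} {t} s∈K a∈Lk t∈L =
        ∪∅-intro P (Link (K ⋆[ 𝕜 ] L) (s ⊎ₛ [])) (a ⊎ₛ t) λ a⊎t≢[] →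
        (a⊎t≢[] , a , t , a∈K a∈Lk , t∈L , ℙ.≋-refl) ,
        ( ⊆-≢[] P {s ⊎ₛ []} (∈-++⁺ˡ P)
            (⊎ₛ-≢[] (SimplicialComplex.nonempty K s∈K))
        , s ++ a , t , inj₁ (s++a∈K a∈Lk) , t∈L , ⊎ₛ-++ s [] a t) ,
        ⊎ₛ-disjoint s a t (disj a∈Lk)
        where
        a∈K : ∀ {a} → (Link K s ∪ ｛ [] ｝) a → (Face K ∪ ｛ [] ｝) a
        a∈K (inj₁ (f , _)) = inj₁ f
        a∈K (inj₂ []≡a)    = inj₂ []≡a
        s++a∈K : ∀ {a} → (Link K s ∪ ｛ [] ｝) a → Face K (s ++ a)
        s++a∈K (inj₁ (_ , f , _)) = f
        s++a∈K (inj₂ refl)        = subst (Face K) (sym (++-identityʳ s)) s∈K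
        disj : ∀ {a} → (Link K s ∪ ｛ [] ｝) a → 𝕊.Disjoint s a
        disj (inj₁ (_ , _ , d)) = d
        disj (inj₂ refl) (_ , ())

      link-⊎ₛ⁻ : ∀ {s u} → (Link (K ⋆[ 𝕜 ] L) (s ⊎ₛ []) ∪ ｛ [] ｝) u →
                 ∃₂ λ a t → (Link K s ∪ ｛ [] ｝) a × (Face L ∪ ｛ [] ｝) t
                          × u ℙ.≋ a ⊎ₛ t
      link-⊎ₛ⁻ (inj₂ refl) = [] , [] , inj₂ refl , inj₂ refl , ℙ.≋-refl
      link-⊎ₛ⁻ {s} {u} (inj₁ ((_ , a , t , a∈K , t∈L , u≋)
                             , (_ , a′ , t′ , a′∈K , _ , su≋) , disj)) =
        a , t , ∪∅-intro E (Link K s) a a∈Lk , t∈L , u≋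
        where
        su⊆ : (s ++ a) ⊎ₛ t ℙ.⊆ a′ ⊎ₛ t′
        -- The pair `a′`, `t′` merely represents the union of `s ⊎ₛ []` and `u` as a face of the
        -- join. Cancelling this inclusion gives `s ++ a ⊆ a′`, so `s ++ a` is a face by
        -- down-closure.
        su⊆ y = proj₁ su≋ (ℙ.++-mono-⊆ {s ⊎ₛ []} (λ z → z) (proj₂ u≋)
                            (proj₂ (⊎ₛ-++ s [] a t) y))
        a∈Lk : a ≢ [] → Link K s a
        a∈Lk a≢[] =
          face∪∅-down E K a∈K (λ y → y) a≢[] ,
          face∪∅-down E K a′∈K (⊎ₛ-cancelˡ (s ++ a) t a′ t′ su⊆)
            (⊆-≢[] E {a} (∈-++⁺ʳ E s) a≢[]) ,
          λ (y∈s , y∈a) → disj (∈-⊎ₛ⁺ˡ y∈s , proj₂ u≋ (∈-⊎ₛ⁺ˡ y∈a))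

      module _ {s : List E.Carrier} (s∈K : Face K s)
               {x : E.Carrier} (x∉V : ¬ Vertex K x) where

        private
          [σK]⋆L = σ K s s∈K x x∉V ⋆[ 𝕜 ] L
          σ[K⋆L] = σ (K ⋆[ 𝕜 ] L) (s ⊎ₛ []) (join-face 𝕜 K L s∈K)
                     (x , 0#) (join-¬vertex 𝕜 K L 0≉1 x∉V)

        cone-⊎ₛ : ∀ {c} → (｛ [] ｝ ∪ ｛ [ x ] ｝) c →
                  (｛ [] ｝ ∪ ｛ [ x , 0# ] ｝) (c ⊎ₛ [])
        cone-⊎ₛ (inj₁ refl) = inj₁ refl
        cone-⊎ₛ (inj₂ refl) = inj₂ refl

        cone-⊎ₛ⁻ : ∀ {c} → (｛ [] ｝ ∪ ｛ [ x , 0# ] ｝) c →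
                   ∃[ c′ ] (｛ [] ｝ ∪ ｛ [ x ] ｝) c′ × c ≡ c′ ⊎ₛ []
        cone-⊎ₛ⁻ (inj₁ refl) = []    , inj₁ refl , refl
        cone-⊎ₛ⁻ (inj₂ refl) = [ x ] , inj₂ refl , refl

        [σ]⋆⊆σ[⋆] : ∀ {u} → Face [σK]⋆L u → Face σ[K⋆L] u
        -- With an empty first component, `s ⊎ₛ []` inside `u` would force `s` to be empty, so `u`
        -- is a face that the subdivision keeps.
        [σ]⋆⊆σ[⋆] (u≢[] , _ , t , inj₂ refl , t∈L , u≋) = inj₁
          ( (u≢[] , [] , t , inj₂ refl , t∈L , u≋)
          , λ s⊆u → SimplicialComplex.nonempty K s∈K
              (𝕊.⊆[]⇒≡[] (⊎ₛ-cancelˡ s [] [] t (λ y → proj₁ u≋ (s⊆u y)))))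
        [σ]⋆⊆σ[⋆] (u≢[] , v , t , inj₁ (inj₁ (v∈K , s⊈v)) , t∈L , u≋) = inj₁
          ( (u≢[] , v , t , inj₁ v∈K , t∈L , u≋)
          , λ s⊆u → s⊈v (⊎ₛ-cancelˡ s [] v t (λ y → proj₁ u≋ (s⊆u y))))
        [σ]⋆⊆σ[⋆] (u≢[] , v , t , inj₁ (inj₂ (_ , a , b , c , a∈ , b∈ , c∈ , v≋))
                , t∈L , u≋) = inj₂
          -- All of `t` goes into the link part, since boundary and cone only contain points
          -- labelled `0#`.
          ( u≢[] , a ⊎ₛ t , b ⊎ₛ [] , c ⊎ₛ []
          , link-⊎ₛ s∈K a∈ t∈L , ∂-⊎ₛ s b∈ , cone-⊎ₛ c∈
          , ℙ.≋-trans u≋ (ℙ.≋-trans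
              ( ⊎ₛ-mono {v} {t = t} (proj₁ v≋) (λ y → y)
              , ⊎ₛ-mono {a ++ b ++ c} {t = t} (proj₂ v≋) (λ y → y))
              (≋-sym P (⊎ₛ-++₃ a t b c))))

        σ[⋆]⊆[σ]⋆ : ∀ {u} → Face σ[K⋆L] u → Face [σK]⋆L u
        σ[⋆]⊆[σ]⋆ (inj₁ ((u≢[] , v , t , v∈K , t∈L , u≋) , s⊈u)) =
          u≢[] , v , t
          , ∪∅-intro E (StellarFace K s x) v (λ v≢[] → inj₁
              ( face∪∅-down E K v∈K (λ y → y) v≢[]
              , λ s⊆v → s⊈u (λ y →
                  proj₂ u≋ (⊎ₛ-mono {s} {v} {[]} {t} s⊆v (λ ()) y))))
          , t∈L , u≋
        σ[⋆]⊆[σ]⋆ (inj₂ (u≢[] , _ , _ , _ , a∈ , b∈ , c∈ , u≋))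
          with a , t , a∈Lk , t∈L , a≋ ← link-⊎ₛ⁻ a∈
             | b , b∈∂ , b≋ ← ∂-⊎ₛ⁻ s b∈
             | c , c∈x , refl ← cone-⊎ₛ⁻ c∈
          = u≢[] , a ++ b ++ c , t
          -- This union can be empty although `u` is not, namely when `u` comes from `t` alone.
          , ∪∅-intro E (StellarFace K s x) (a ++ b ++ c) (λ ne →
              inj₂ (ne , a , b , c , a∈Lk , b∈∂ , c∈x , 𝕊.≋-refl))
          , t∈L
          , ℙ.≋-trans u≋ (ℙ.≋-trans
              (ℙ.++-cong a≋ (ℙ.++-cong b≋ ℙ.≋-refl)) (⊎ₛ-++₃ a t b c))

proposition3p5 : ∀ {e ε r ρ p q}
    (𝕜 : Semiring r ρ) (0≉1 : Nontrivial 𝕜)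
    (E : Setoid e ε)
    (K : SimplicialComplex E p) (L : SimplicialComplex E q)
    (s : List (Setoid.Carrier E)) (s∈K : Face K s)
    (x : Setoid.Carrier E) (x∉V : ¬ (Vertex K x)) →
    σ K s s∈K x x∉V ⋆[ 𝕜 ] L
    ≅ σ (K ⋆[ 𝕜 ] L)
    (s ⊔ₛ[ 𝕜 ] []) (join-face 𝕜 K L s∈K)
    (x , Semiring.0# 𝕜) (join-¬vertex 𝕜 K L 0≉1 x∉V)
proposition3p5 𝕜 0≉1 E K L s s∈K x x∉V =
  [σ]⋆⊆σ[⋆] 𝕜 E 0≉1 K L s∈K x∉V , σ[⋆]⊆[σ]⋆ 𝕜 E 0≉1 K L s∈K x∉V
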